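{- $\mathbf{GR}^\bullet$ enjoys Lyndon interpolation property. Moreover, for all $\mathcal{L}_2$-formulas $A$ and $B$, if $\mathbf{GR}^\bullet\vdash A\to B$, then there exists an $\mathcal{L}_2$-formula $C$ with $v^+(C)\subseteq v^+(A)\cap v^+(B)$, $v^-(C)\subseteq v^-(A)\cap v^-(B)$, $\mathbf{GR}^\bullet\vdash A\to C$ and $\mathbf{GR}^\bullet\vdash C\to B$, which additionally satisfies: for each $*\in\{+,-\}$ and each $\mathcal{L}_2$-formula $D$, if $\blacksquare D\in S^*(C)$ then $\blacksquare D\in S^*(A)\cap S^*(B)$.
   Context: $\mathcal{L}_2$ is the bimodal propositional language with countably many propositional variables, $\bot$, connectives $\neg,\vee$ (others defined), and unary modal operators $\Box,\blacksquare$; $\Diamond$ abbreviates $\neg\Box\neg$. The logic $\mathbf{GR}^-$ has as axioms all propositional tautologies of $\mathcal{L}_2$ and all instances of $\Box(A\to B)\to(\Box A\to\Box B)$, $\Box(\Box A\to A)\to\Box A$, $\blacksquare A\to\Box A$, $\Box A\to\Box\blacksquare A$, $\Box A\to(\Box\bot\vee\blacksquare A)$, $\Diamond\blacksquare A\to\Diamond A$, and rules modus ponens and $\Box$-necessitation. $\mathbf{GR}^\circ$ is $\mathbf{GR}^-$ plus the rule: from $A$ infer $\blacksquare A$; $\mathbf{GR}^\bullet$ is $\mathbf{GR}^\circ$ plus the rule: from $\neg A$ infer $\neg\blacksquare A$. Positive and negative subformulas: $S^+(A)=\{A\}$ and $S^-(A)=\emptyset$ if $A$ is a variable or $\bot$;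 $S^+(B\vee C)=S^+(B)\cup S^+(C)\cup\{B\vee C\}$, $S^-(B\vee C)=S^-(B)\cup S^-(C)$; $S^+(\neg B)=S^-(B)\cup\{\neg B\}$, $S^-(\neg B)=S^+(B)$; for $\circledast\in\{\Box,\blacksquare\}$, $S^+(\circledast B)=S^+(B)\cup\{\circledast B\}$, $S^-(\circledast B)=S^-(B)$. $v(A)$ is the set of variables in $A$; $v^*(A)=S^*(A)\cap v(A)$. A logic $L$ has Lyndon interpolation property if whenever $L\vdash A\to B$ there is $C$ with $v^*(C)\subseteq v^*(A)\cap v^*(B)$ for $*\in\{+,-\}$, $L\vdash A\to C$ and $L\vdash C\to B$. -}

module Defs where

open import Data.Nat using (ℕ)
open import Data.Bool using (Bool; true; false; not; _∨_)
open import Data.Product using (Σ; _×_; _,_)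
open import Relation.Binary.PropositionalEquality using (_≡_)

data Fm : Set where
  var  : ℕ → Fm
  ⊥'   : Fm
  ¬'_  : Fm → Fm
  _∨'_ : Fm → Fm → Fm
  □_   : Fm → Fm
  ■_   : Fm → Fm

infixr 6 _∨'_
infixr 5 _⇒_
infix 7 ¬'_ □_ ■_ ◇_

_⇒_ : Fm → Fm → Fm
A ⇒ B = (¬' A) ∨' B

◇_ : Fm → Fm
◇ A = ¬' (□ (¬' A))

-- Propositional tautologies of L2: true under every Boolean assignment to
-- the propositional atoms, which are variables and formulas □B, ■B.
eval : (Fm → Bool) → Fm → Bool
eval v (var n)  = v (var n)
eval v ⊥'       = false
eval v (¬' A)   = not (eval v A)
eval v (A ∨' B) = eval v A ∨ eval v B
eval v (□ A)    = v (□ A)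
eval v (■ A)    = v (■ A)

Tautology : Fm → Set
Tautology A = (v : Fm → Bool) → eval v A ≡ true

data Axiom : Fm → Set where
  taut : ∀ {A} → Tautology A → Axiom A
  K    : ∀ A B → Axiom (□ (A ⇒ B) ⇒ (□ A ⇒ □ B))
  Löb  : ∀ A → Axiom (□ (□ A ⇒ A) ⇒ □ A)
  ax1  : ∀ A → Axiom (■ A ⇒ □ A)
  ax2  : ∀ A → Axiom (□ A ⇒ □ (■ A))
  ax3  : ∀ A → Axiom (□ A ⇒ ((□ ⊥') ∨' (■ A)))
  ax4  : ∀ A → Axiom (◇ (■ A) ⇒ ◇ A)

data GR● : Fm → Set where
  ax    : ∀ {A} → Axiom A → GR● A
  mp    : ∀ {A B} → GR● (A ⇒ B) → GR● A → GR● B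
  nec   : ∀ {A} → GR● A → GR● (□ A)
  ■nec  : ∀ {A} → GR● A → GR● (■ A)
  ■rosser : ∀ {A} → GR● (¬' A) → GR● (¬' (■ A))

data Sign : Set where
  + - : Sign

flip : Sign → Sign
flip + = -
flip - = +

data S : Sign → Fm → Fm → Set where
  var-self : ∀ n → S + (var n) (var n)
  ⊥-self   : S + ⊥' ⊥'
  ∨-self   : ∀ B C → S + (B ∨' C) (B ∨' C)
  ∨-l      : ∀ {s B C X} → S s B X → S s (B ∨' C) X
  ∨-r      : ∀ {s B C X} → S s C X → S s (B ∨' C) X
  ¬-self   : ∀ B → S + (¬' B) (¬' B)
  ¬-in     : ∀ {s B X} → S (flip s) B X → S s (¬' B) X
  □-self   : ∀ B → S + (□ B) (□ B)
  □-in     : ∀ {s B X} → S s B X → S s (□ B) X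
  ■-self   : ∀ B → S + (■ B) (■ B)
  ■-in     : ∀ {s B X} → S s B X → S s (■ B) X

V : Sign → Fm → ℕ → Set
V s A n = S s A (var n)

LyndonInterpolant : Fm → Fm → Fm → Set
LyndonInterpolant A B C =
  ((s : Sign) (n : ℕ) → V s C n → V s A n × V s B n)
  × GR● (A ⇒ C) × GR● (C ⇒ B)

LyndonIP : Set
LyndonIP = (A B : Fm) → GR● (A ⇒ B) → Σ Fm (λ C → LyndonInterpolant A B C)

{-# OPTIONS --safe #-}
module Submission where

-- In GR● the modality ■ agrees with □ at worlds having successors, and at end worlds ■ D is
-- an atom subject only to this: if ■ D is true (false) there, then some sibling makes D true
-- (false).  We run a tableau search for a tree model of A and ¬ B, with the descendants of A
-- on the left and those of ¬ B on the right; each failed state has an interpolant.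
--
-- A demand for a successor satisfying u may, by Löb's principle, assume that u fails above
-- that successor.  This assumption goes into a history: it is available to the derivations
-- of its side and closes branches, but it is never decomposed, so it does not contribute to
-- the variables and polarities of the interpolant.  The history also grows at a fixed world:
-- when the search for a successor satisfying u fails with interpolant C, then u is recorded
-- as impossible at the price of a disjunct ◇ C (u on the left) or a conjunct □ C (u on the
-- right).  When nothing can be added, every subformula outside the history has a witness
-- among the successors, so the ■-atoms of end worlds outside the history are unconstrained.

open import Defs
open import Data.Bool using (Bool; true; false; not; _∨_; _∧_)
open import Data.Empty using (⊥; ⊥-elim)
open import Data.List using (List; []; _∷_; _++_; map; length; filter)
open import Data.List.Membership.Propositional using (_∈_; _∉_; find)
open import Data.List.Membership.Propositional.Properties
  using (∈-++⁺ˡ; ∈-++⁺ʳ; ∈-++⁻; ∈-map⁺; ∈-map⁻; ∈-filter⁺)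
open import Data.List.Properties using (filter-notAll; ++-assoc; ++-identityʳ)
open import Data.List.Relation.Unary.All using (All; []; _∷_; lookup; tabulate)
import Data.List.Relation.Unary.All as All
open import Data.List.Relation.Unary.All.Properties using (map⁺; map⁻; ++⁺; ++⁻ˡ; ++⁻ʳ)
open import Data.List.Relation.Unary.Any using (Any; here; there; any?)
import Data.List.Relation.Unary.Any as Any
open import Data.Maybe using (Maybe; just; nothing; fromMaybe)
open import Data.Nat using (ℕ; _<_)
import Data.Nat as ℕ
open import Data.Nat.Induction using (<-wellFounded)
open import Data.Product using (Σ; ∃; ∃₂; _×_; _,_; proj₁; proj₂)
open import Data.Sum using (_⊎_; inj₁; inj₂)
open import Data.Unit using (⊤; tt)
open import Function using (_∘_; id)
open import Induction.WellFounded using (Acc; acc)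
open import Relation.Binary.Definitions using (DecidableEquality)
open import Relation.Binary.PropositionalEquality using (_≡_; _≢_; refl; sym; trans; cong; cong₂; subst)
open import Relation.Nullary using (¬_; Dec; yes; no; does; ¬?)
open import Relation.Nullary.Decidable using (dec-true; dec-false)

⊤' : Fm
⊤' = ¬' ⊥'

-- Propositional reasoning

-- A record, so that the formula can be inferred from the type.
record _⊨_ (v : Fm → Bool) (X : Fm) : Set where
  constructor holds
  field evaluates : eval v X ≡ true
open _⊨_

infix 3 _⊨_ _⊢_

module _ {v : Fm → Bool} where

  ⊨-dec : ∀ X → (v ⊨ X) ⊎ (¬ (v ⊨ X))
  ⊨-dec X with eval v X in eq
  ... | true  = inj₁ (holds eq)
  ... | false = inj₂ λ { (holds p) → case-false (trans (sym eq) p) }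
    where
    case-false : false ≡ true → ⊥
    case-false ()

  ⊥E : v ⊨ ⊥' → ⊥
  ⊥E (holds ())

  ¬I : ∀ {X} → (v ⊨ X → ⊥) → v ⊨ ¬' X
  ¬I {X} f with eval v X in eq
  ... | true  = ⊥-elim (f (holds eq))
  ... | false = holds (cong not eq)

  ¬E : ∀ {X} → v ⊨ ¬' X → v ⊨ X → ⊥
  ¬E {X} (holds p) (holds q) with eval v X
  ¬E {X} (holds ()) (holds q) | true
  ¬E {X} (holds p) (holds ()) | false

  ¬¬E : ∀ {X} → ¬ ¬ (v ⊨ X) → v ⊨ X
  ¬¬E {X} f with ⊨-dec X
  ... | inj₁ p = p
  ... | inj₂ n = ⊥-elim (f n)

  ∨I₁ : ∀ {X Y} → v ⊨ X → v ⊨ X ∨' Y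
  ∨I₁ {X} {Y} (holds p) = holds (cong (_∨ eval v Y) p)

  ∨I₂ : ∀ {X Y} → v ⊨ Y → v ⊨ X ∨' Y
  ∨I₂ {X} {Y} (holds p) with eval v X in eq
  ... | true  = holds (cong (_∨ eval v Y) eq)
  ... | false = holds (trans (cong (_∨ eval v Y) eq) p)

  ∨E : ∀ {X Y} → v ⊨ X ∨' Y → (v ⊨ X) ⊎ (v ⊨ Y)
  ∨E {X} {Y} (holds p) with eval v X in eq
  ... | true  = inj₁ (holds eq)
  ... | false = inj₂ (holds p)

  ⇒I : ∀ {X Y} → (v ⊨ X → v ⊨ Y) → v ⊨ X ⇒ Y
  ⇒I {X} f with ⊨-dec X
  ... | inj₁ p = ∨I₂ (f p)
  ... | inj₂ n = ∨I₁ (¬I n)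

  ⇒E : ∀ {X Y} → v ⊨ X ⇒ Y → v ⊨ X → v ⊨ Y
  ⇒E p x with ∨E p
  ... | inj₁ n = ⊥-elim (¬E n x)
  ... | inj₂ y = y

  ⊤I : v ⊨ ⊤'
  ⊤I = holds refl

taut₀ : ∀ {X} → (∀ v → v ⊨ X) → GR● X
taut₀ f = ax (taut λ v → evaluates (f v))

taut₁ : ∀ {P X} → GR● P → (∀ v → v ⊨ P → v ⊨ X) → GR● X
taut₁ p f = mp (taut₀ λ v → ⇒I (f v)) p

taut₂ : ∀ {P Q X} → GR● P → GR● Q → (∀ v → v ⊨ P → v ⊨ Q → v ⊨ X) → GR● X
taut₂ p q f = mp (taut₁ p λ v a → ⇒I (f v a)) q

_⊨*_ : (Fm → Bool) → List Fm → Set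
v ⊨* Γ = All (v ⊨_) Γ

imps : List Fm → Fm → Fm
imps []      C = C
imps (X ∷ Γ) C = X ⇒ imps Γ C

imps-intro : ∀ {v C} Γ → (v ⊨* Γ → v ⊨ C) → v ⊨ imps Γ C
imps-intro []      f = f []
imps-intro (X ∷ Γ) f = ⇒I λ x → imps-intro Γ λ h → f (x ∷ h)

imps-elim : ∀ {v C Γ} → v ⊨ imps Γ C → v ⊨* Γ → v ⊨ C
imps-elim p []      = p
imps-elim p (x ∷ h) = imps-elim (⇒E p x) h

record _⊢_ (Γ : List Fm) (C : Fm) : Set where
  constructor derive
  field theorem : GR● (imps Γ C)
open _⊢_

infer₀ : ∀ {Γ C} → (∀ v → v ⊨* Γ → v ⊨ C) → Γ ⊢ C
infer₀ {Γ} f = derive (taut₀ λ v → imps-intro Γ (f v))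

infer₁ : ∀ {Γ C Γ₁ C₁} → Γ₁ ⊢ C₁ → (∀ v → (v ⊨* Γ₁ → v ⊨ C₁) → v ⊨* Γ → v ⊨ C) → Γ ⊢ C
infer₁ {Γ} (derive p) f = derive (taut₁ p λ v a → imps-intro Γ (f v (imps-elim a)))

infer₂ : ∀ {Γ C Γ₁ C₁ Γ₂ C₂} → Γ₁ ⊢ C₁ → Γ₂ ⊢ C₂ →
         (∀ v → (v ⊨* Γ₁ → v ⊨ C₁) → (v ⊨* Γ₂ → v ⊨ C₂) → v ⊨* Γ → v ⊨ C) → Γ ⊢ C
infer₂ {Γ} (derive p) (derive q) f =
  derive (taut₂ p q λ v a b → imps-intro Γ (f v (imps-elim a) (imps-elim b)))

hyp : ∀ {Γ C} → C ∈ Γ → Γ ⊢ C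
hyp i = infer₀ λ v h → lookup h i

weaken : ∀ {Γ X} → GR● X → Γ ⊢ X
weaken p = infer₁ {Γ₁ = []} (derive p) λ v a _ → a []

apply : ∀ {Γ X Y} → GR● (X ⇒ Y) → Γ ⊢ X → Γ ⊢ Y
apply p d = infer₂ {Γ₁ = []} (derive p) d λ v a b h → ⇒E (a []) (b h)

cut : ∀ {Δ Γ C} → All (Δ ⊢_) Γ → Γ ⊢ C → Δ ⊢ C
cut []       d = infer₁ d λ v a _ → a []
cut (p ∷ ps) d =
  infer₂ p (cut ps (infer₁ {C = _ ⇒ _} d λ v a h → ⇒I λ x → a (x ∷ h))) λ v a b h → ⇒E (b h) (a h)

-- Derived modal rules

□-imps : ∀ Γ C → GR● (□ (imps Γ C) ⇒ imps (map □_ Γ) (□ C))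
□-imps []      C = taut₀ λ v → ⇒I id
□-imps (X ∷ Γ) C =
  taut₂ (ax (K X (imps Γ C))) (□-imps Γ C) λ v a b → ⇒I λ p → ⇒I λ x → ⇒E b (⇒E (⇒E a p) x)

□-cut : ∀ {Δ Γ C} → All (λ X → Δ ⊢ □ X) Γ → Γ ⊢ C → Δ ⊢ □ C
□-cut {Γ = Γ} {C} ps (derive d) = cut (map⁺ ps) (derive (mp (□-imps Γ C) (nec d)))

-- Necessitating `□ C ⇒ C` under the boxed hypotheses gives the premise of the Löb axiom, so `□ C`
-- is a free assumption.
löb-cut : ∀ {Δ Γ C} → All (λ X → Δ ⊢ □ X) Γ → □ C ∷ Γ ⊢ C → Δ ⊢ □ C
löb-cut ps d = apply (ax (Löb _)) (□-cut ps (infer₁ d λ v a h → ⇒I λ x → a (x ∷ h)))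

□-mono : ∀ {X Y} → GR● (X ⇒ Y) → GR● (□ X ⇒ □ Y)
□-mono p = mp (ax (K _ _)) (nec p)

⇒-trans : ∀ {X Y Z} → GR● (X ⇒ Y) → GR● (Y ⇒ Z) → GR● (X ⇒ Z)
⇒-trans p q = taut₂ p q λ v a b → ⇒I λ x → ⇒E b (⇒E a x)

-- Transitivity passes through `■`: `□ X` yields `□ (■ X)`, and `■ X ⇒ □ X` holds under the box.
□-trans : ∀ X → GR● (□ X ⇒ □ (□ X))
□-trans X = ⇒-trans (ax (ax2 X)) (□-mono (ax (ax1 X)))

□¬■ : ∀ X → GR● (□ (¬' X) ⇒ □ (¬' (■ X)))
□¬■ X = taut₁ (ax (ax4 X)) λ v a → ⇒I λ p → ¬¬E λ n → ¬E (⇒E a (¬I n)) p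

-- Signed subformulas

_·_ : Sign → Sign → Sign
+ · t = t
- · t = flip t

flip-flip : ∀ s → flip (flip s) ≡ s
flip-flip + = refl
flip-flip - = refl

flip-· : ∀ s t → flip s · t ≡ flip (s · t)
flip-· + t = refl
flip-· - t = sym (flip-flip t)

flip-·-flip : ∀ s t → flip s · flip t ≡ s · t
flip-·-flip + t = flip-flip t
flip-·-flip - t = refl

S-refl : ∀ X → S + X X
S-refl (var n)  = var-self n
S-refl ⊥'       = ⊥-self
S-refl (¬' X)   = ¬-self X
S-refl (X ∨' Y) = ∨-self X Y
S-refl (□ X)    = □-self X
S-refl (■ X)    = ■-self X

S-trans : ∀ {s t X Y Z} → S s X Y → S t Y Z → S (s · t) X Z
S-trans (var-self n) q = q
S-trans ⊥-self       q = q
S-trans (∨-self B C) q = q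
S-trans (∨-l p)      q = ∨-l (S-trans p q)
S-trans (∨-r p)      q = ∨-r (S-trans p q)
S-trans (¬-self B)   q = q
S-trans {s} {t} (¬-in p) q = ¬-in (subst (λ r → S r _ _) (flip-· s t) (S-trans p q))
S-trans (□-self B)   q = q
S-trans (□-in p)     q = □-in (S-trans p q)
S-trans (■-self B)   q = q
S-trans (■-in p)     q = ■-in (S-trans p q)

subs : Fm → List (Sign × Fm)
subs (var n)  = (+ , var n) ∷ []
subs ⊥'       = (+ , ⊥') ∷ []
subs (¬' X)   = (+ , ¬' X) ∷ map (λ (s , Y) → flip s , Y) (subs X)
subs (X ∨' Y) = (+ , X ∨' Y) ∷ subs X ++ subs Y
subs (□ X)    = (+ , □ X) ∷ subs X
subs (■ X)    = (+ , ■ X) ∷ subs X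

subs-complete : ∀ {s X Y} → S s X Y → (s , Y) ∈ subs X
subs-complete (var-self n) = here refl
subs-complete ⊥-self       = here refl
subs-complete (∨-self B C) = here refl
subs-complete (∨-l p)      = there (∈-++⁺ˡ (subs-complete p))
subs-complete {X = B ∨' C} (∨-r p) = there (∈-++⁺ʳ (subs B) (subs-complete p))
subs-complete (¬-self B)   = here refl
subs-complete {s} {X = ¬' B} {Y} (¬-in p) =
  there (subst (λ t → (t , Y) ∈ map _ (subs B)) (flip-flip s) (∈-map⁺ _ (subs-complete p)))
subs-complete (□-self B)   = here refl
subs-complete (□-in p)     = there (subs-complete p)
subs-complete (■-self B)   = here refl
subs-complete (■-in p)     = there (subs-complete p)

subs-sound : ∀ X {s Y} → (s , Y) ∈ subs X → S s X Y
subs-sound (var n)  (here refl) = var-self n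
subs-sound ⊥'       (here refl) = ⊥-self
subs-sound (¬' X)   (here refl) = ¬-self X
subs-sound (¬' X)   (there i) with ∈-map⁻ _ i
... | (t , Y) , j , refl = ¬-in (subst (λ r → S r X Y) (sym (flip-flip t)) (subs-sound X j))
subs-sound (X ∨' Y) (here refl) = ∨-self X Y
subs-sound (X ∨' Y) (there i) with ∈-++⁻ (subs X) i
... | inj₁ j = ∨-l (subs-sound X j)
... | inj₂ j = ∨-r (subs-sound Y j)
subs-sound (□ X)    (here refl) = □-self X
subs-sound (□ X)    (there i)   = □-in (subs-sound X i)
subs-sound (■ X)    (here refl) = ■-self X
subs-sound (■ X)    (there i)   = ■-in (subs-sound X i)

-- Tree models

-- `dual s X` is the negation of `signed s X` with double negations removed, so that `neg■ u`
-- follows from `neg u` by a single application of a `■`-rule.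
signed dual : Sign → Fm → Fm
signed + X = X
signed - X = ¬' X
dual + X = ¬' X
dual - X = X

signed-dual : ∀ {v} s {X} → v ⊨ signed s X → v ⊨ dual s X → ⊥
signed-dual + p q = ¬E q p
signed-dual - p q = ¬E p q

dual-intro : ∀ {v} s {X} → (v ⊨ signed s X → ⊥) → v ⊨ dual s X
dual-intro + f = ¬I f
dual-intro - f = ¬¬E λ n → f (¬I n)

signOf : Bool → Sign
signOf true  = +
signOf false = -

-- A world is a finite tree whose proper subtrees are its accessible worlds.  At an end
-- the truth value of ■ D is that of D unless it is overridden; elsewhere ■ is □.
data Tree : Set where
  end  : (ℕ → Bool) → (Fm → Maybe Bool) → Tree
  node : (ℕ → Bool) → List Tree → Tree

sat  : Tree → Fm → Bool
satL : List Tree → Fm → Bool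

sat (end v o)   (var n)  = v n
sat (end v o)   ⊥'       = false
sat (end v o)   (¬' X)   = not (sat (end v o) X)
sat (end v o)   (X ∨' Y) = sat (end v o) X ∨ sat (end v o) Y
sat (end v o)   (□ X)    = true
sat (end v o)   (■ X)    = fromMaybe (sat (end v o) X) (o X)
sat (node v ts) (var n)  = v n
sat (node v ts) ⊥'       = false
sat (node v ts) (¬' X)   = not (sat (node v ts) X)
sat (node v ts) (X ∨' Y) = sat (node v ts) X ∨ sat (node v ts) Y
sat (node v ts) (□ X)    = satL ts X
sat (node v ts) (■ X)    = satL ts X

satL []       X = true
-- The conjunct `sat t (□ X)` reaches the deeper subtrees and makes accessibility transitive.
satL (t ∷ ts) X = sat t X ∧ (sat t (□ X) ∧ satL ts X)

-- Since `⊩` evaluates with modal formulas as atoms, this is what links it to the recursive truth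
-- value used in `satL`.
eval-sat : ∀ t X → eval (sat t) X ≡ sat t X
eval-sat (end v o)   (var n)  = refl
eval-sat (end v o)   ⊥'       = refl
eval-sat (end v o)   (¬' X)   = cong not (eval-sat (end v o) X)
eval-sat (end v o)   (X ∨' Y) = cong₂ _∨_ (eval-sat (end v o) X) (eval-sat (end v o) Y)
eval-sat (end v o)   (□ X)    = refl
eval-sat (end v o)   (■ X)    = refl
eval-sat (node v ts) (var n)  = refl
eval-sat (node v ts) ⊥'       = refl
eval-sat (node v ts) (¬' X)   = cong not (eval-sat (node v ts) X)
eval-sat (node v ts) (X ∨' Y) = cong₂ _∨_ (eval-sat (node v ts) X) (eval-sat (node v ts) Y)
eval-sat (node v ts) (□ X)    = refl
eval-sat (node v ts) (■ X)    = refl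

infix 3 _⊩_
_⊩_ : Tree → Fm → Set
t ⊩ X = sat t ⊨ X

∧-true : ∀ {a b} → a ≡ true → b ≡ true → a ∧ b ≡ true
∧-true refl q = q

∧-true⁻ : ∀ {a b} → a ∧ b ≡ true → a ≡ true × b ≡ true
∧-true⁻ {true} q = refl , q

satL-intro : ∀ {X ts} → All (λ t → (t ⊩ X) × (t ⊩ □ X)) ts → satL ts X ≡ true
satL-intro [] = refl
satL-intro {X} {t ∷ ts} ((holds p , holds q) ∷ h) =
  ∧-true (trans (sym (eval-sat t X)) p) (∧-true q (satL-intro h))

satL-elim : ∀ {X} ts → satL ts X ≡ true → All (λ t → (t ⊩ X) × (t ⊩ □ X)) ts
satL-elim []       p = []
satL-elim {X} (t ∷ ts) p with ∧-true⁻ p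
... | a , q with ∧-true⁻ q
... | b , r = (holds (trans (eval-sat t X) a) , holds b) ∷ satL-elim ts r

□I : ∀ {v X ts} → All (λ t → (t ⊩ X) × (t ⊩ □ X)) ts → node v ts ⊩ □ X
□I h = holds (satL-intro h)

□E : ∀ {v X ts} → node v ts ⊩ □ X → All (λ t → (t ⊩ X) × (t ⊩ □ X)) ts
□E {ts = ts} (holds p) = satL-elim ts p

■⇒□ : ∀ t {X} → t ⊩ ■ X → t ⊩ □ X
■⇒□ (end v o)   _         = holds refl
■⇒□ (node v ts) (holds p) = holds p

□⇒■-node : ∀ {v ts X} → node v ts ⊩ □ X → node v ts ⊩ ■ X
□⇒■-node (holds p) = holds p

-- Well-formed trees and soundness

Witnessed : List Tree → Tree → Set
Witnessed ts (end v o)   = ∀ D b → o D ≡ just b → Any (_⊩ signed (signOf b) D) ts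
Witnessed ts (node v us) = ⊤

-- Only overrides need witnesses: by default `■ D` has the value of `D` at the end, which is one of
-- the `ts` itself. The existence of a successor is phrased as a witness of `⊤'`, the form in which
-- a met demand provides it.
WF  : Tree → Set
WFs : List Tree → Set
WF (end v o)   = ⊤
WF (node v ts) = Any (_⊩ ⊤') ts × WFs ts × All (Witnessed ts) ts
WFs []       = ⊤
WFs (t ∷ ts) = WF t × WFs ts

WFs-intro : ∀ {ts} → All WF ts → WFs ts
WFs-intro []      = tt
WFs-intro (p ∷ h) = p , WFs-intro h

child-WF : ∀ {ts t} → WFs ts → t ∈ ts → WF t
child-WF (w , ws) (here refl) = w
child-WF (w , ws) (there i)   = child-WF ws i

refuted : ∀ {ts : List Tree} {P Q : Tree → Set} → Any P ts → All Q ts → (∀ {t} → P t → Q t → ⊥) → ⊥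
refuted (here p)  (q ∷ _) f = f p q
refuted (there i) (_ ∷ h) f = refuted i h f

-- The successor worlds are treated from the leaves downwards, so □ Z may be used at a
-- successor when proving Z there; this is Löb's principle.
module _ {Z : Fm} (Φ : Tree → Set)
         (hereditary : ∀ {v ts t} → Φ (node v ts) → t ∈ ts → Φ t)
         (forced : ∀ {v ts t} → WF (node v ts) → Φ (node v ts) → t ∈ ts → t ⊩ □ Z → t ⊩ Z) where

  □-induction  : ∀ t → WF t → Φ t → t ⊩ □ Z
  □-inductions : ∀ ts → WFs ts → (∀ {t} → t ∈ ts → Φ t) → (∀ {t} → t ∈ ts → t ⊩ □ Z → t ⊩ Z) →
                 All (λ t → (t ⊩ Z) × (t ⊩ □ Z)) ts

  □-induction (end v o)   _ _ = holds refl
  □-induction (node v ts) w φ = □I (□-inductions ts (proj₁ (proj₂ w)) (hereditary φ) (forced w φ))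

  □-inductions []       _        _ _ = []
  □-inductions (t ∷ ts) (w , ws) φ f =
    let b = □-induction t w (φ (here refl))
    in (f (here refl) b , b) ∷ □-inductions ts ws (φ ∘ there) (f ∘ there)

□-child : ∀ {X v ts t} → node v ts ⊩ □ X → t ∈ ts → (t ⊩ X) × (t ⊩ □ X)
□-child p i = lookup (□E p) i

-- At an inner successor `■` is `□`. At an end, an override to false would come with a sibling
-- refuting `A`, against `□ A` at the parent.
⊩-■ : ∀ {v ts t A} → WF (node v ts) → node v ts ⊩ □ A → t ∈ ts → t ⊩ ■ A
⊩-■ {t = node _ _} w p i = □⇒■-node (proj₂ (□-child p i))
⊩-■ {t = end v o} {A} w p i with o A in eq
... | just true  = holds (cong (fromMaybe _) eq)
... | just false = ⊥-elim (refuted (lookup (proj₂ (proj₂ w)) i A false eq) (□E p) λ n q → ¬E n (proj₁ q))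
... | nothing    =
  holds (trans (cong (fromMaybe _) eq) (trans (sym (eval-sat (end v o) A)) (evaluates (proj₁ (□-child p i)))))

-- An inner successor has a successor of its own, where `A` and its negation would meet. At an end,
-- an override to true would come with a sibling satisfying `A`.
⊩-¬■ : ∀ {v ts t A} → WF (node v ts) → node v ts ⊩ □ (¬' A) → t ∈ ts → t ⊩ ¬' (■ A)
⊩-¬■ {ts = ts} {t = node _ us} {A} w p i = ¬I λ q →
  refuted (proj₁ (child-WF (proj₁ (proj₂ w)) i)) (All.zip (□E (proj₂ (□-child p i)) , □E (■⇒□ (node _ us) q)))
          λ _ (n , a) → ¬E (proj₁ n) (proj₁ a)
⊩-¬■ {t = end v o} {A} w p i with o A in eq
... | just true  = ⊥-elim (refuted (lookup (proj₂ (proj₂ w)) i A true eq) (□E p) λ a q → ¬E (proj₁ q) a)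
... | just false = holds (cong (not ∘ fromMaybe _) eq)
... | nothing    =
  ¬I λ (holds q) → ¬E (proj₁ (□-child p i))
    (holds (trans (eval-sat (end v o) A) (trans (sym (cong (fromMaybe (sat (end v o) A)) eq)) q)))

□⇒□■ : ∀ {A} t → WF t → t ⊩ □ A → t ⊩ □ (■ A)
□⇒□■ {A} = □-induction (_⊩ □ A) (λ p i → proj₂ (□-child p i)) λ w p i _ → ⊩-■ w p i

□¬⇒□¬■ : ∀ {A} t → WF t → t ⊩ □ (¬' A) → t ⊩ □ (¬' (■ A))
□¬⇒□¬■ {A} = □-induction (_⊩ □ (¬' A)) (λ p i → proj₂ (□-child p i)) λ w p i _ → ⊩-¬■ w p i

□-K : ∀ {A B} t → WF t → (t ⊩ □ (A ⇒ B)) × (t ⊩ □ A) → t ⊩ □ B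
□-K {A} {B} = □-induction (λ t → (t ⊩ □ (A ⇒ B)) × (t ⊩ □ A))
  (λ (p , q) i → proj₂ (□-child p i) , proj₂ (□-child q i))
  λ _ (p , q) i _ → ⇒E (proj₁ (□-child p i)) (proj₁ (□-child q i))

axiom-sound : ∀ {A} → Axiom A → ∀ t → WF t → t ⊩ A
axiom-sound (taut p) t w = holds (p (sat t))
axiom-sound (K A B)  t w = ⇒I λ p → ⇒I λ q → □-K t w (p , q)
axiom-sound (Löb A)  t w = ⇒I (□-induction (_⊩ □ (□ A ⇒ A)) (λ p i → proj₂ (□-child p i))
                                 (λ _ p i b → ⇒E (proj₁ (□-child p i)) b) t w)
axiom-sound (ax1 A)  t w = ⇒I (■⇒□ t)
axiom-sound (ax2 A)  t w = ⇒I (□⇒□■ t w)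
axiom-sound (ax3 A) (end _ _)  w = ⇒I λ _ → ∨I₁ (holds refl)
axiom-sound (ax3 A) (node _ _) w = ⇒I λ p → ∨I₂ (□⇒■-node p)
axiom-sound (ax4 A)  t w = ⇒I λ p → ¬I λ n → ¬E p (□¬⇒□¬■ t w n)

-- The rules A / ■ A and ¬ A / ¬ ■ A fail at single worlds, but they are sound for the
-- truth of □ A, by the axioms □ A ⇒ □ ■ A and ◇ ■ A ⇒ ◇ A.
sound : ∀ {A} → GR● A → ∀ t → WF t → t ⊩ □ A
sound (ax a)      t w = □-induction WF (λ w i → child-WF (proj₁ (proj₂ w)) i)
                          (λ w _ i _ → axiom-sound a _ (child-WF (proj₁ (proj₂ w)) i)) t w w
sound (mp p q)    t w = □-K t w (sound p t w , sound q t w)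
sound (nec {A} p) t w = □-induction (_⊩ □ A) (λ q i → proj₂ (□-child q i))
                          (λ _ q i _ → proj₂ (□-child q i)) t w (sound p t w)
sound (■nec p)    t w = □⇒□■ t w (sound p t w)
sound (■rosser p) t w = □¬⇒□¬■ t w (sound p t w)

-- Marked formulas

-- A negative answer carries no proof, so one clause covers all mismatched constructors; reflexivity
-- recovers the refutation.
≟-Maybe : (A B : Fm) → Maybe (A ≡ B)
≟-Maybe (var m) (var n) with m ℕ.≟ n
... | yes refl = just refl
... | no _     = nothing
≟-Maybe ⊥' ⊥' = just refl
≟-Maybe (¬' A) (¬' B) with ≟-Maybe A B
... | just refl = just refl
... | nothing   = nothing
≟-Maybe (A ∨' B) (C ∨' D) with ≟-Maybe A C | ≟-Maybe B D
... | just refl | just refl = just refl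
... | _         | _         = nothing
≟-Maybe (□ A) (□ B) with ≟-Maybe A B
... | just refl = just refl
... | nothing   = nothing
≟-Maybe (■ A) (■ B) with ≟-Maybe A B
... | just refl = just refl
... | nothing   = nothing
≟-Maybe _ _ = nothing

≟-Maybe-refl : (A : Fm) → ≟-Maybe A A ≢ nothing
≟-Maybe-refl (var n) with n ℕ.≟ n
... | yes refl = λ ()
... | no n≢n   = λ _ → n≢n refl
≟-Maybe-refl ⊥' = λ ()
≟-Maybe-refl (¬' A) with ≟-Maybe A A | ≟-Maybe-refl A
... | just refl | _ = λ ()
... | nothing   | p = λ _ → p refl
≟-Maybe-refl (A ∨' B) with ≟-Maybe A A | ≟-Maybe-refl A | ≟-Maybe B B | ≟-Maybe-refl B
... | just refl | _ | just refl | _ = λ ()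
... | nothing   | p | _         | _ = λ _ → p refl
... | just refl | _ | nothing   | p = λ _ → p refl
≟-Maybe-refl (□ A) with ≟-Maybe A A | ≟-Maybe-refl A
... | just refl | _ = λ ()
... | nothing   | p = λ _ → p refl
≟-Maybe-refl (■ A) with ≟-Maybe A A | ≟-Maybe-refl A
... | just refl | _ = λ ()
... | nothing   | p = λ _ → p refl

_≟F_ : DecidableEquality Fm
A ≟F B with ≟-Maybe A B in eq
... | just p  = yes p
... | nothing = no λ { refl → ≟-Maybe-refl A eq }

-- L carries the antecedent of the implication to be interpolated, R its succedent.
data Side : Set where
  L R : Side

_≟Side_ : DecidableEquality Side
L ≟Side L = yes refl
L ≟Side R = no λ ()
R ≟Side L = no λ ()
R ≟Side R = yes refl

_≟Sign_ : DecidableEquality Sign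
+ ≟Sign + = yes refl
+ ≟Sign - = no λ ()
- ≟Sign + = no λ ()
- ≟Sign - = yes refl

record Marked : Set where
  constructor mk
  field
    side : Side
    sign : Sign
    form : Fm
open Marked

_≟M_ : DecidableEquality Marked
mk i s X ≟M mk j t Y with i ≟Side j | s ≟Sign t | X ≟F Y
... | yes refl | yes refl | yes refl = yes refl
... | no n     | _        | _        = no λ { refl → n refl }
... | _        | no n     | _        = no λ { refl → n refl }
... | _        | _        | no n     = no λ { refl → n refl }

_∈?_ : ∀ (u : Marked) H → Dec (u ∈ H)
u ∈? H = any? (u ≟M_) H

-- A formula belonging to side j, as seen from side i.
at : Side → Side → Fm → Fm
at L L X = X
at L R X = ⊤'
at R L X = ⊤'
at R R X = X

at-intro : ∀ {v} i j {X} → v ⊨ X → v ⊨ at i j X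
at-intro L L p = p
at-intro L R p = ⊤I
at-intro R L p = ⊤I
at-intro R R p = p

at-same : ∀ {v} i {X} → v ⊨ at i i X → v ⊨ X
at-same L p = p
at-same R p = p

at-other : ∀ {v} i j {X} → i ≢ j → v ⊨ at i j X
at-other L L n = ⊥-elim (n refl)
at-other L R n = ⊤I
at-other R L n = ⊤I
at-other R R n = ⊥-elim (n refl)

at-map : ∀ {v} i j {X Y} → (v ⊨ X → v ⊨ Y) → v ⊨ at i j X → v ⊨ at i j Y
at-map L L f p = f p
at-map L R f p = ⊤I
at-map R L f p = ⊤I
at-map R R f p = f p

at-□ : ∀ i j {Δ Z Y} → GR● (Z ⇒ □ Y) → Δ ⊢ at i j Z → Δ ⊢ □ (at i j Y)
at-□ L L p d = apply p d
at-□ L R p d = weaken (nec (taut₀ λ _ → ⊤I))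
at-□ R L p d = weaken (nec (taut₀ λ _ → ⊤I))
at-□ R R p d = apply p d

fm neg neg■ : Marked → Fm
fm   (mk _ s X) = signed s X
neg  (mk _ s X) = dual s X
neg■ (mk _ s X) = dual s (■ X)

fmAt □negAt neg■At : Side → Marked → Fm
fmAt   i u = at i (side u) (fm u)
□negAt i u = at i (side u) (□ neg u)
neg■At i u = at i (side u) (neg■ u)

_⊨[_]_ : (Fm → Bool) → Side → List Marked → Set
v ⊨[ i ] Γ = All (λ u → v ⊨ fmAt i u) Γ

_⊩*_ : Tree → List Marked → Set
t ⊩* Γ = All (λ u → t ⊩ fm u) Γ

⊨[]-intro : ∀ {v Γ} → All (λ u → v ⊨ fm u) Γ → ∀ i → v ⊨[ i ] Γ
⊨[]-intro h i = All.map (λ {u} → at-intro i (side u)) h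

⊨[]-elim : ∀ {v} Γ → (∀ i → v ⊨[ i ] Γ) → All (λ u → v ⊨ fm u) Γ
⊨[]-elim Γ h = tabulate λ {u} m → at-same (side u) (lookup (h (side u)) m)

Context : Set
Context = Side → List Fm

hyps : Side → List Marked → Context → List Fm
hyps i Γ Θ = map (fmAt i) Γ ++ Θ i

hyps-intro : ∀ {v i Γ Θ} → v ⊨[ i ] Γ → v ⊨* Θ i → v ⊨* hyps i Γ Θ
hyps-intro p q = ++⁺ (map⁺ p) q

hyps-marked : ∀ {v i} Γ Θ → v ⊨* hyps i Γ Θ → v ⊨[ i ] Γ
hyps-marked Γ Θ h = map⁻ (++⁻ˡ (map _ Γ) h)

hyps-context : ∀ {v i} Γ Θ → v ⊨* hyps i Γ Θ → v ⊨* Θ i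
hyps-context Γ Θ h = ++⁻ʳ (map _ Γ) h

-- An interpolant `C` is derived on the left and refuted on the right. Accordingly `join`, `dia` and
-- `bot` are disjunction, possibility and falsity for `L` and their duals for `R`. The double
-- negation makes `dia R C` literally `□ (¬' (sgn R C))`.
sgn : Side → Fm → Fm
sgn L C = C
sgn R C = ¬' C

join : Side → Fm → Fm → Fm
join L C D = C ∨' D
join R C D = ¬' (¬' C ∨' ¬' D)

dia : Side → Fm → Fm
dia L C = ¬' (□ (¬' C))
dia R C = □ (¬' (¬' C))

bot : Side → Fm
bot L = ⊥'
bot R = ⊤'

module _ {v : Fm → Bool} where

  join-same : ∀ i {C D} → (v ⊨ sgn i C) ⊎ (v ⊨ sgn i D) → v ⊨ sgn i (join i C D)
  join-same L (inj₁ p) = ∨I₁ p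
  join-same L (inj₂ p) = ∨I₂ p
  join-same R (inj₁ p) = ¬I λ q → ¬E q (∨I₁ p)
  join-same R (inj₂ p) = ¬I λ q → ¬E q (∨I₂ p)

  join-any : ∀ i j {C D} → v ⊨ sgn j C → v ⊨ sgn j D → v ⊨ sgn j (join i C D)
  join-any L L p q = ∨I₁ p
  join-any L R p q = ¬I λ r → or (∨E r)
    where
    or : _ ⊎ _ → ⊥
    or (inj₁ x) = ¬E p x
    or (inj₂ x) = ¬E q x
  join-any R L p q = ¬I λ r → or (∨E r)
    where
    or : _ ⊎ _ → ⊥
    or (inj₁ x) = ¬E x p
    or (inj₂ x) = ¬E x q
  join-any R R p q = ¬I λ r → ¬E r (∨I₁ p)

  dia-same : ∀ i {C} → ¬ (v ⊨ □ (¬' (sgn i C))) → v ⊨ sgn i (dia i C)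
  dia-same L p = ¬I p
  dia-same R p = ¬I p

  dia-other : ∀ i j {C} → j ≢ i → v ⊨ □ (¬' (sgn i C)) → v ⊨ sgn j (dia i C)
  dia-other L L n p = ⊥-elim (n refl)
  dia-other L R n p = ¬I λ q → ¬E q p
  dia-other R L n p = p
  dia-other R R n p = ⊥-elim (n refl)

  sgn-other : ∀ i j {C} → j ≢ i → v ⊨ sgn j C → v ⊨ ¬' (sgn i C)
  sgn-other L L n p = ⊥-elim (n refl)
  sgn-other L R n p = p
  sgn-other R L n p = ¬I λ q → ¬E q p
  sgn-other R R n p = ⊥-elim (n refl)

  bot-other : ∀ i j → j ≢ i → v ⊨ sgn j (bot i)
  bot-other L L n = ⊥-elim (n refl)
  bot-other L R n = ⊤I
  bot-other R L n = ⊤I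
  bot-other R R n = ⊥-elim (n refl)

-- Passing to a successor

boxes : List Marked → List Marked
boxes [] = []
boxes (mk i + (□ D) ∷ Γ) = mk i + D ∷ mk i + (□ D) ∷ boxes Γ
boxes (mk i + (■ D) ∷ Γ) = mk i + D ∷ mk i + (■ D) ∷ boxes Γ
boxes (_ ∷ Γ) = boxes Γ

data Literal : Fm → Set where
  var : ∀ n → Literal (var n)
  box : ∀ D → Literal (□ D)
  sqr : ∀ D → Literal (■ D)

-- The history H lists marked formulas that, on their own side, fail at all accessible
-- worlds.  In childK H H' the world is a successor of one with history H, and H' is its own
-- history.
terminalK nodeK : List Marked → Context
childK : List Marked → List Marked → Context
terminalK H i = □ ⊥' ∷ map (neg■At i) H
nodeK     H i = ¬' (□ ⊥') ∷ map (□negAt i) H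
childK H H' i = map (□negAt i) H' ++ map (neg■At i) H

-- By these two axioms the history of a world constrains the `■`-literals of its successors.
□-neg⇒□-neg■ : ∀ u → GR● (□ neg u ⇒ □ neg■ u)
□-neg⇒□-neg■ (mk i + X) = □¬■ X
□-neg⇒□-neg■ (mk i - X) = ax (ax2 X)

-- A true `■ D` persists because it implies `□ D` and hence `□ (■ D)`. Keeping `■ D` instead of
-- `□ D` stays within the subformulas.
boxes-□ : ∀ i {Δ} Γ → All (λ u → Δ ⊢ fmAt i u) Γ → All (λ u → Δ ⊢ □ fmAt i u) (boxes Γ)
boxes-□ i [] [] = []
boxes-□ i (mk j + (var _) ∷ Γ) (p ∷ h) = boxes-□ i Γ h
boxes-□ i (mk j + ⊥' ∷ Γ) (p ∷ h) = boxes-□ i Γ h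
boxes-□ i (mk j + (¬' _) ∷ Γ) (p ∷ h) = boxes-□ i Γ h
boxes-□ i (mk j + (_ ∨' _) ∷ Γ) (p ∷ h) = boxes-□ i Γ h
boxes-□ i (mk j + (□ D) ∷ Γ) (p ∷ h) =
  at-□ i j (taut₀ λ _ → ⇒I id) p ∷ at-□ i j (□-trans D) p ∷ boxes-□ i Γ h
boxes-□ i (mk j + (■ D) ∷ Γ) (p ∷ h) =
  at-□ i j (ax (ax1 D)) p ∷ at-□ i j (⇒-trans (ax (ax1 D)) (ax (ax2 D))) p ∷ boxes-□ i Γ h
boxes-□ i (mk j - _ ∷ Γ) (p ∷ h) = boxes-□ i Γ h

inherited : Side → List Marked → List Marked → List Fm
inherited i Γ H = map (fmAt i) (boxes Γ) ++ map (□negAt i) H ++ map (neg■At i) H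

inherited-□ : ∀ i {Δ} Γ H → All (Δ ⊢_) (hyps i Γ (nodeK H)) → All (λ X → Δ ⊢ □ X) (inherited i Γ H)
inherited-□ i Γ H h with map⁻ (++⁻ˡ (map (fmAt i) Γ) h) | ++⁻ʳ (map (fmAt i) Γ) h
... | p | _ ∷ q =
  ++⁺ (map⁺ (boxes-□ i Γ p))
      (++⁺ (map⁺ (All.map (λ {u} → at-□ i (side u) (□-trans (neg u))) (map⁻ q)))
           (map⁺ (All.map (λ {u} → at-□ i (side u) (□-neg⇒□-neg■ u)) (map⁻ q))))

module _ {u : Marked} {Γ H : List Marked} where

  -- Löb's principle supplies the `□ neg u` that the child's history `u ∷ H` presupposes; as `C` is
  -- refuted at the successor, so is `u`.
  step-same : ∀ {C} → hyps (side u) (u ∷ boxes Γ) (childK H (u ∷ H)) ⊢ C →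
              □ (¬' C) ∷ hyps (side u) Γ (nodeK H) ⊢ □ neg u
  step-same {C} d =
    löb-cut (hyp (here refl) ∷ inherited-□ i Γ H (tabulate λ m → hyp (there m)))
      (infer₁ d λ { v a (□n ∷ c ∷ h) → dual-intro (sign u) λ p → ¬E c
        (a (at-intro i i p ∷
            ++⁺ (++⁻ˡ (map (fmAt i) (boxes Γ)) h)
                (at-intro i i □n ∷ ++⁻ʳ (map (fmAt i) (boxes Γ)) h))) })
    where
    i = side u

  -- Seen from the other side, `u` and its history entry are `⊤'`, so no appeal to Löb's principle
  -- is made.
  step-other : ∀ {j C D} → j ≢ side u → (∀ {v} → v ⊨ C → v ⊨ D) →
               hyps j (u ∷ boxes Γ) (childK H (u ∷ H)) ⊢ C → hyps j Γ (nodeK H) ⊢ □ D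
  step-other {j} n f d =
    □-cut (inherited-□ j Γ H (tabulate hyp))
      (infer₁ d λ v a h → f
        (a (at-other j (side u) n ∷
            ++⁺ (++⁻ˡ (map (fmAt j) (boxes Γ)) h)
                (at-other j (side u) n ∷ ++⁻ʳ (map (fmAt j) (boxes Γ)) h))))

-- Interpolants of states

-- The formulas whose signed occurrences are controlled; the boxes that `dia` introduces are exempt.
data Atom : Fm → Set where
  var : ∀ n → Atom (var n)
  sqr : ∀ D → Atom (■ D)

scan : ∀ {R P Q : Marked → Set} → (∀ {u} → R u → P u ⊎ Q u) → ∀ {Γ} → All R Γ → Any P Γ ⊎ All Q Γ
scan f [] = inj₂ []
scan f (r ∷ rs) with f r | scan f rs
... | inj₁ p | _      = inj₁ (here p)
... | inj₂ _ | inj₁ i = inj₁ (there i)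
... | inj₂ q | inj₂ h = inj₂ (q ∷ h)

decide : ∀ {P : Set} → Dec P → P ⊎ (¬ P)
decide (yes p) = inj₁ p
decide (no n)  = inj₂ n

has? : ∀ s X Γ → Dec (∃ λ i → mk i s X ∈ Γ)
has? s X Γ with mk L s X ∈? Γ | mk R s X ∈? Γ
... | yes p | _     = yes (L , p)
... | no _  | yes q = yes (R , q)
... | no m  | no n  = no λ { (L , p) → m p ; (R , q) → n q }

Consistent : List Marked → Set
Consistent Γ = ∀ {i j X} → mk i + X ∈ Γ → mk j - X ∈ Γ → ⊥

consistent? : ∀ Γ → (∃₂ λ i j → ∃ λ X → mk i + X ∈ Γ × mk j - X ∈ Γ) ⊎ Consistent Γ
consistent? Γ with scan {R = _∈ Γ} {P = λ u → sign u ≡ - × u ∈ Γ × ∃ λ i → mk i + (form u) ∈ Γ}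
                        {Q = λ u → sign u ≡ - → ∀ i → ¬ (mk i + (form u) ∈ Γ)} test (tabulate id)
  where
  test : ∀ {u} → u ∈ Γ → _ ⊎ _
  test {mk j + X} m = inj₂ λ ()
  test {mk j - X} m with has? + X Γ
  ... | yes p = inj₁ (refl , m , p)
  ... | no n  = inj₂ λ _ i p → n (i , p)
... | inj₂ h = inj₂ λ p n → lookup h n refl _ p
... | inj₁ c with Any.satisfied c
... | mk j - X , refl , n , i , p = inj₁ (i , j , X , p , n)

ite : Fm → Fm → Fm → Fm
ite P C D = ¬' (¬' P ∨' ¬' C) ∨' ¬' (P ∨' ¬' D)

sgn-ite : ∀ {v} j {P C D} → (v ⊨ P → v ⊨ sgn j C) → (v ⊨ ¬' P → v ⊨ sgn j D) → v ⊨ sgn j (ite P C D)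
sgn-ite {v} j {P} f g with ⊨-dec {v} P
sgn-ite {v} L {P} {C} {D} f g | inj₁ p = ∨I₁ (¬I λ q → ∨-elim (∨E q))
  where
  ∨-elim : (v ⊨ ¬' P) ⊎ (v ⊨ ¬' C) → ⊥
  ∨-elim (inj₁ x) = ¬E x p
  ∨-elim (inj₂ x) = ¬E x (f p)
sgn-ite {v} L {P} {C} {D} f g | inj₂ n = ∨I₂ (¬I λ q → ∨-elim (∨E q))
  where
  ∨-elim : (v ⊨ P) ⊎ (v ⊨ ¬' D) → ⊥
  ∨-elim (inj₁ x) = n x
  ∨-elim (inj₂ x) = ¬E x (g (¬I n))
sgn-ite {v} R {P} {C} {D} f g | inj₁ p = ¬I λ q → ∨-elim (∨E q)
  where
  ∨-elim : (v ⊨ ¬' (¬' P ∨' ¬' C)) ⊎ (v ⊨ ¬' (P ∨' ¬' D)) → ⊥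
  ∨-elim (inj₁ x) = ¬E x (∨I₂ (f p))
  ∨-elim (inj₂ x) = ¬E x (∨I₁ p)
sgn-ite {v} R {P} {C} {D} f g | inj₂ n = ¬I λ q → ∨-elim (∨E q)
  where
  ∨-elim : (v ⊨ ¬' (¬' P ∨' ¬' C)) ⊎ (v ⊨ ¬' (P ∨' ¬' D)) → ⊥
  ∨-elim (inj₁ x) = ¬E x (∨I₁ (¬I n))
  ∨-elim (inj₂ x) = ¬E x (∨I₂ (g (¬I n)))

All-shift : ∀ {P : Marked → Set} {u} Γ {Δ} → All P (u ∷ Γ ++ Δ) → All P (Γ ++ u ∷ Δ)
All-shift Γ (p ∷ h) = ++⁺ (++⁻ˡ Γ h) (p ∷ ++⁻ʳ Γ h)

All-unshift : ∀ {P : Marked → Set} {u} Γ {Δ} → All P (Γ ++ u ∷ Δ) → All P (u ∷ Γ ++ Δ)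
All-unshift Γ h with ++⁻ʳ Γ h
... | p ∷ q = p ∷ ++⁺ (++⁻ˡ Γ h) q

-- The reasons for a literal to fail at an end: it refutes a box, or it is a `■`-literal whose
-- sibling witness the history excludes.
data TerminalClash (H : List Marked) : Marked → Set where
  box : ∀ {i D} → TerminalClash H (mk i - (□ D))
  sqr : ∀ {i s D} → mk i s D ∈ H → TerminalClash H (mk i s (■ D))

terminalClash? : ∀ H {u} → Literal (form u) → Dec (TerminalClash H u)
terminalClash? H {mk i s _} (var n) = no λ ()
terminalClash? H {mk i + _} (box D) = no λ ()
terminalClash? H {mk i - _} (box D) = yes box
terminalClash? H {mk i s _} (sqr D) with mk i s D ∈? H
... | yes m = yes (sqr m)
... | no n  = no λ { (sqr m) → n m }

-- The successor that the literal demands is already recorded as impossible.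
data NodeClash (H : List Marked) : Marked → Set where
  box : ∀ {i D} → mk i - D ∈ H → NodeClash H (mk i - (□ D))
  sqr : ∀ {i D} → mk i - D ∈ H → NodeClash H (mk i - (■ D))

nodeClash? : ∀ H {u} → Literal (form u) → Dec (NodeClash H u)
nodeClash? H {mk i + _} (box D) = no λ ()
nodeClash? H {mk i + _} (sqr D) = no λ ()
nodeClash? H {mk i s _} (var n) = no λ ()
nodeClash? H {mk i - _} (box D) with mk i - D ∈? H
... | yes m = yes (box m)
... | no n  = no λ { (box m) → n m }
nodeClash? H {mk i - _} (sqr D) with mk i - D ∈? H
... | yes m = yes (sqr m)
... | no n  = no λ { (sqr m) → n m }

valuation : List Marked → ℕ → Bool
valuation Γ n = does (has? + (var n) Γ)

override : List Marked → Fm → Maybe Bool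
override Γ D with has? + (■ D) Γ | has? - (■ D) Γ
... | yes _ | _     = just true
... | no _  | yes _ = just false
... | no _  | no _  = nothing

valuation-true : ∀ {Γ i n} → mk i + (var n) ∈ Γ → valuation Γ n ≡ true
valuation-true {Γ} {n = n} m = dec-true (has? + (var n) Γ) (_ , m)

valuation-false : ∀ {Γ i n} → Consistent Γ → mk i - (var n) ∈ Γ → valuation Γ n ≡ false
valuation-false {Γ} {n = n} c m = dec-false (has? + (var n) Γ) λ (_ , p) → c p m

override-true : ∀ {Γ i D} → mk i + (■ D) ∈ Γ → override Γ D ≡ just true
override-true {Γ} {D = D} m with has? + (■ D) Γ | has? - (■ D) Γ
... | yes _ | _ = refl
... | no n  | _ = ⊥-elim (n (_ , m))

override-false : ∀ {Γ i D} → Consistent Γ → mk i - (■ D) ∈ Γ → override Γ D ≡ just false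
override-false {Γ} {D = D} c m with has? + (■ D) Γ | has? - (■ D) Γ
... | yes (_ , p) | _     = ⊥-elim (c p m)
... | no _        | yes _ = refl
... | no _        | no n  = ⊥-elim (n (_ , m))

override-literal : ∀ {Γ D} b → override Γ D ≡ just b → ∃ λ i → mk i (signOf b) (■ D) ∈ Γ
override-literal {Γ} {D} b eq with has? + (■ D) Γ | has? - (■ D) Γ
override-literal true  eq | yes p | _     = p
override-literal false eq | no _  | yes p = p

boxes-literal : ∀ {i Γ D} → (mk i + (□ D) ∈ Γ → mk i + D ∈ boxes Γ × mk i + (□ D) ∈ boxes Γ) ×
                            (mk i + (■ D) ∈ Γ → mk i + D ∈ boxes Γ × mk i + (■ D) ∈ boxes Γ)
boxes-literal {Γ = []} = (λ ()) , (λ ())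
boxes-literal {i} {u ∷ Γ} {D} with boxes-literal {i} {Γ} {D}
... | f , g = (λ { (here refl) → here refl , there (here refl) ; (there m) → skip u (f m) })
            , (λ { (here refl) → here refl , there (here refl) ; (there m) → skip u (g m) })
  where
  later : ∀ u {w} → w ∈ boxes Γ → w ∈ boxes (u ∷ Γ)
  later (mk j + (□ _)) m = there (there m)
  later (mk j + (■ _)) m = there (there m)
  later (mk j + (var _)) m = m
  later (mk j + ⊥') m = m
  later (mk j + (¬' _)) m = m
  later (mk j + (_ ∨' _)) m = m
  later (mk j - _) m = m
  skip : ∀ u {w w′} → w ∈ boxes Γ × w′ ∈ boxes Γ → w ∈ boxes (u ∷ Γ) × w′ ∈ boxes (u ∷ Γ)
  skip u (m , n) = later u m , later u n

-- Polarities of interpolants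

module _ (A B : Fm) where

  Shared : Sign → Fm → Set
  Shared s X = S s A X × S s B X

  -- The sign `s` is that of the position where `C` will stand in the final interpolant; this makes
  -- the condition pass through negation.
  record Good (s : Sign) (C : Fm) : Set where
    constructor good
    field shared : ∀ t X → Atom X → S t C X → Shared (s · t) X

  good-⊥ : ∀ {s} → Good s ⊥'
  good-⊥ = good λ { _ _ () ⊥-self }

  good-¬ : ∀ {s C} → Good (flip s) C → Good s (¬' C)
  good-¬ {s} (good g) = good λ
    { _ _ () (¬-self _)
    ; t X a (¬-in p) → subst (λ r → Shared r X) (flip-·-flip s t) (g (flip t) X a p) }

  good-∨ : ∀ {s C D} → Good s C → Good s D → Good s (C ∨' D)
  good-∨ (good g) (good h) = good λ
    { _ _ () (∨-self _ _)
    ; t X a (∨-l p) → g t X a p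
    ; t X a (∨-r p) → h t X a p }

  good-□ : ∀ {s C} → Good s C → Good s (□ C)
  good-□ (good g) = good λ
    { _ _ () (□-self _)
    ; t X a (□-in p) → g t X a p }

  good-join : ∀ i {C D} → Good + C → Good + D → Good + (join i C D)
  good-join L g h = good-∨ g h
  good-join R g h = good-¬ (good-∨ (good-¬ g) (good-¬ h))

  good-dia : ∀ i {C} → Good + C → Good + (dia i C)
  good-dia L g = good-¬ (good-□ (good-¬ g))
  good-dia R g = good-□ (good-¬ (good-¬ g))

  good-bot : ∀ i → Good + (bot i)
  good-bot L = good-⊥
  good-bot R = good-¬ good-⊥

  good-ite : ∀ {P C D} → (∀ {s} → Good s P) → Good + C → Good + D → Good + (ite P C D)
  good-ite p g h = good-∨ (good-¬ (good-∨ (good-¬ p) (good-¬ g))) (good-¬ (good-∨ p (good-¬ h)))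

  -- The constructor top makes the existence of a successor one of the searched demands.
  data Sub : Marked → Set where
    left  : ∀ {s X} → S s A X → Sub (mk L s X)
    right : ∀ {s X} → S (flip s) B X → Sub (mk R s X)
    top   : Sub (mk L - ⊥')

  sub-trans : ∀ {i s t X Y} → Sub (mk i s X) → S t X Y → Sub (mk i (s · t) Y)
  sub-trans (left p) q = left (S-trans p q)
  sub-trans {s = s} {t} (right p) q = right (subst (λ r → S r B _) (flip-· s t) (S-trans p q))
  sub-trans top ⊥-self = top

  sub-+ : ∀ {i s X Y} → Sub (mk i s X) → S + X Y → Sub (mk i s Y)
  sub-+ {s = +} p q = sub-trans p q
  sub-+ {s = - } p q = sub-trans p q

  -- The right side starts from `¬' B`, so opposite signs on the two sides are equal signs in `A`
  -- and `B`.
  good-sub : ∀ {s X} → Sub (mk L s X) → Sub (mk R (flip s) X) → Good s X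
  good-sub {s} (left p) (right q) = good λ t Y a r →
    S-trans p r , S-trans (subst (λ w → S w B _) (flip-flip s) q) r
  good-sub top _ = good-⊥

  candidates : List Marked
  candidates = mk L - ⊥' ∷ map (λ (s , X) → mk L s X) (subs A) ++ map (λ (s , X) → mk R (flip s) X) (subs B)

  sub⇒candidate : ∀ {u} → Sub u → u ∈ candidates
  sub⇒candidate (left p) = there (∈-++⁺ˡ (∈-map⁺ _ (subs-complete p)))
  sub⇒candidate {mk R s X} (right p) =
    there (∈-++⁺ʳ (map _ (subs A))
      (subst (λ r → mk R r X ∈ map _ (subs B)) (flip-flip s) (∈-map⁺ _ (subs-complete p))))
  sub⇒candidate top = here refl

  candidate⇒sub : ∀ {u} → u ∈ candidates → Sub u
  candidate⇒sub (here refl) = top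
  candidate⇒sub (there i) with ∈-++⁻ (map (λ (s , X) → mk L s X) (subs A)) i
  ... | inj₁ j with ∈-map⁻ _ j
  ... | (s , X) , m , refl = left (subs-sound A m)
  candidate⇒sub (there i) | inj₂ j with ∈-map⁻ _ j
  ... | (s , X) , m , refl = right (subst (λ r → S r B X) (sym (flip-flip s)) (subs-sound B m))

  boxes-sub : ∀ Γ → All Sub Γ → All Sub (boxes Γ)
  boxes-sub [] [] = []
  boxes-sub (mk j + (var _) ∷ Γ) (p ∷ h) = boxes-sub Γ h
  boxes-sub (mk j + ⊥' ∷ Γ) (p ∷ h) = boxes-sub Γ h
  boxes-sub (mk j + (¬' _) ∷ Γ) (p ∷ h) = boxes-sub Γ h
  boxes-sub (mk j + (_ ∨' _) ∷ Γ) (p ∷ h) = boxes-sub Γ h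
  boxes-sub (mk j + (□ D) ∷ Γ) (p ∷ h) = sub-+ p (□-in (S-refl D)) ∷ p ∷ boxes-sub Γ h
  boxes-sub (mk j + (■ D) ∷ Γ) (p ∷ h) = sub-+ p (■-in (S-refl D)) ∷ p ∷ boxes-sub Γ h
  boxes-sub (mk j - _ ∷ Γ) (p ∷ h) = boxes-sub Γ h

  record Interpolant (Γ : List Marked) (Θ : Context) : Set where
    constructor interpolant
    field
      formula : Fm
      polar   : Good + formula
      derived : ∀ i → hyps i Γ Θ ⊢ sgn i formula

  rebase : ∀ {Γ Δ Θ Ξ} → (∀ i v → v ⊨* hyps i Δ Ξ → v ⊨* hyps i Γ Θ) → Interpolant Γ Θ → Interpolant Δ Ξ
  rebase f (interpolant C g d) = interpolant C g λ i → infer₁ (d i) λ v a h → a (f i v h)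

  close : ∀ {Γ Θ} i → hyps i Γ Θ ⊢ ⊥' → Interpolant Γ Θ
  close {Γ} {Θ} i d = interpolant (bot i) (good-bot i) side-derivation
    where
    side-derivation : ∀ j → hyps j Γ Θ ⊢ sgn j (bot i)
    side-derivation j with j ≟Side i
    ... | yes refl = infer₁ d λ v a h → ⊥-elim (⊥E (a h))
    ... | no n     = infer₀ λ v h → bot-other i j n

  -- A pair on one side makes that side inconsistent. A pair split between the sides is separated by
  -- `X` or its negation, which `good-sub` admits.
  clash : ∀ {Γ Θ i j X} → All Sub Γ → mk i + X ∈ Γ → mk j - X ∈ Γ → Interpolant Γ Θ
  clash {Γ} {Θ} {i = L} {L} _ p n = close L (infer₀ λ v h → ⊥-elim
    (¬E (lookup (hyps-marked Γ Θ h) n) (lookup (hyps-marked Γ Θ h) p)))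
  clash {Γ} {Θ} {i = R} {R} _ p n = close R (infer₀ λ v h → ⊥-elim
    (¬E (lookup (hyps-marked Γ Θ h) n) (lookup (hyps-marked Γ Θ h) p)))
  clash {Γ} {Θ} {i = L} {R} {X} s p n = interpolant X (good-sub (lookup s p) (lookup s n))
    λ { L → infer₀ λ v h → lookup (hyps-marked Γ Θ h) p
      ; R → infer₀ λ v h → lookup (hyps-marked Γ Θ h) n }
  clash {Γ} {Θ} {i = R} {L} {X} s p n = interpolant (¬' X) (good-¬ (good-sub (lookup s n) (lookup s p)))
    λ { L → infer₀ λ v h → lookup (hyps-marked Γ Θ h) n
      ; R → infer₀ λ v h → ¬I λ q → ¬E q (lookup (hyps-marked Γ Θ h) p) }

  -- Saturation to literals

  module Saturation (Θ : Context) (Ok : Tree → Set) where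

    Outcome : List Marked → Set
    Outcome Γ = Interpolant Γ Θ ⊎ ∃ λ t → Ok t × t ⊩* Γ

    convert : ∀ {Γ Δ} → (∀ i v → v ⊨[ i ] Δ → v ⊨[ i ] Γ) → (∀ i v → v ⊨[ i ] Γ → v ⊨[ i ] Δ) →
              Outcome Γ → Outcome Δ
    convert {Δ = Δ} f g (inj₁ I) =
      inj₁ (rebase (λ i v h → hyps-intro {Θ = Θ} (f i v (hyps-marked Δ Θ h)) (hyps-context Δ Θ h)) I)
    convert {Δ = Δ} f g (inj₂ (t , ok , h)) = inj₂ (t , ok , ⊨[]-elim Δ λ i → g i _ (⊨[]-intro h i))

    branch : ∀ {i X Y Γ} → Outcome (mk i + X ∷ Γ) → Outcome (mk i + Y ∷ Γ) → Outcome (mk i + (X ∨' Y) ∷ Γ)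
    branch (inj₂ (t , ok , p ∷ h)) _ = inj₂ (t , ok , ∨I₁ p ∷ h)
    branch (inj₁ _) (inj₂ (t , ok , p ∷ h)) = inj₂ (t , ok , ∨I₂ p ∷ h)
    branch {i} {X} {Y} {Γ} (inj₁ (interpolant C g d)) (inj₁ (interpolant D h e)) =
      inj₁ (interpolant (join i C D) (good-join i g h) side-derivation)
      where
      side-derivation : ∀ j → hyps j (mk i + (X ∨' Y) ∷ Γ) Θ ⊢ sgn j (join i C D)
      side-derivation j with j ≟Side i
      ... | no n = infer₂ (d j) (e j) λ { v a b (p ∷ h) →
              join-any i j (a (at-other j i n ∷ h)) (b (at-other j i n ∷ h)) }
      ... | yes refl = infer₂ (d i) (e i) λ { v a b (p ∷ h) → join-same i (cases a b h (∨E (at-same i p))) }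
        where
        cases : ∀ {v h X' Y'} → (v ⊨* (at i i X ∷ h) → X') → (v ⊨* (at i i Y ∷ h) → Y') →
                v ⊨* h → (v ⊨ X) ⊎ (v ⊨ Y) → X' ⊎ Y'
        cases a b h (inj₁ x) = inj₁ (a (at-intro i i x ∷ h))
        cases a b h (inj₂ y) = inj₂ (b (at-intro i i y ∷ h))

    -- A continuation: it finishes the state once the literals `Λ` of the decomposed formulas are
    -- known, which keeps `decompose` structurally recursive.
    OnLiterals : List Marked → Set
    OnLiterals Γ = ∀ Λ → All Sub Λ → All (Literal ∘ form) Λ → Outcome (Λ ++ Γ)

    decompose : ∀ X i s Γ → Sub (mk i s X) → OnLiterals Γ → Outcome (mk i s X ∷ Γ)
    decompose (var n) i s Γ p k = k (mk i s (var n) ∷ []) (p ∷ []) (var n ∷ [])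
    decompose (□ X) i s Γ p k = k (mk i s (□ X) ∷ []) (p ∷ []) (box X ∷ [])
    decompose (■ X) i s Γ p k = k (mk i s (■ X) ∷ []) (p ∷ []) (sqr X ∷ [])
    decompose ⊥' i + Γ p k = inj₁ (close i (infer₀ λ { v (q ∷ _) → at-same i q }))
    decompose ⊥' i - Γ p k =
      convert (λ { j v (_ ∷ h) → h }) (λ j v h → at-intro j i ⊤I ∷ h) (k [] [] [])
    decompose (¬' X) i s Γ p k =
      convert (λ { j v (q ∷ h) → at-map j i (to s) q ∷ h }) (λ { j v (q ∷ h) → at-map j i (from s) q ∷ h })
        (decompose X i (flip s) Γ (subst (λ r → Sub (mk i r X)) (·- s) (sub-trans p (¬-in (S-refl X)))) k)
      where
      ·- : ∀ s → s · - ≡ flip s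
      ·- + = refl
      ·- - = refl
      to : ∀ {v} s → v ⊨ signed s (¬' X) → v ⊨ signed (flip s) X
      to + q = q
      to - q = ¬¬E λ n → ¬E q (¬I n)
      from : ∀ {v} s → v ⊨ signed (flip s) X → v ⊨ signed s (¬' X)
      from + q = q
      from - q = ¬I λ n → ¬E n q
    decompose (X ∨' Y) i + Γ p k =
      branch (decompose X i + Γ (sub-+ p (∨-l (S-refl X))) k) (decompose Y i + Γ (sub-+ p (∨-r (S-refl Y))) k)
    decompose (X ∨' Y) i - Γ p k =
      convert (λ { j v (q ∷ h) → at-map j i (λ n → ¬I λ x → ¬E n (∨I₁ x)) q ∷
                                 at-map j i (λ n → ¬I λ y → ¬E n (∨I₂ y)) q ∷ h })
              (λ { j v (q ∷ r ∷ h) → both j q r ∷ h })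
        (decompose X i - (mk i - Y ∷ Γ) (sub-+ p (∨-l (S-refl X))) λ Λ sΛ lΛ →
          convert (λ j v → All-unshift Λ) (λ j v → All-shift Λ)
            (decompose Y i - (Λ ++ Γ) (sub-+ p (∨-r (S-refl Y))) λ Λ′ sΛ′ lΛ′ →
              subst Outcome (++-assoc Λ′ Λ Γ) (k (Λ′ ++ Λ) (++⁺ sΛ′ sΛ) (++⁺ lΛ′ lΛ))))
      where
      neither : ∀ {v} → v ⊨ ¬' X → v ⊨ ¬' Y → v ⊨ ¬' (X ∨' Y)
      neither m n = ¬I λ x → ∨-elim (∨E x)
        where
        ∨-elim : _ ⊎ _ → ⊥
        ∨-elim (inj₁ x) = ¬E m x
        ∨-elim (inj₂ y) = ¬E n y
      both : ∀ {v} j → v ⊨ at j i (¬' X) → v ⊨ at j i (¬' Y) → v ⊨ at j i (¬' (X ∨' Y))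
      both j q r with j ≟Side i
      ... | yes refl = at-intro i i (neither (at-same i q) (at-same i r))
      ... | no n     = at-other j i n

    saturate : OnLiterals [] → ∀ Γ → All Sub Γ → OnLiterals Γ
    saturate k [] _ = k
    saturate k (mk i s X ∷ Γ) (p ∷ ps) Λ sΛ lΛ =
      convert (λ j v → All-unshift Λ) (λ j v → All-shift Λ)
        (decompose X i s (Λ ++ Γ) p λ Λ′ sΛ′ lΛ′ →
          subst Outcome (++-assoc Λ′ Λ Γ) (saturate k Γ ps (Λ′ ++ Λ) (++⁺ sΛ′ sΛ) (++⁺ lΛ′ lΛ)))

  -- Search for a countermodel

  -- A condition on an end alone, before its siblings are known: each override rests on a demand
  -- outside `H`, which the completed parent will have met.
  Supported : List Marked → Tree → Set
  Supported H (end v o)  = ∀ D b → o D ≡ just b → ∃ λ i → Sub (mk i (signOf b) D) × mk i (signOf b) D ∉ H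
  Supported H (node _ _) = ⊤

  Ok : List Marked → Tree → Set
  Ok H t = WF t × Supported H t

  Child : List Marked → List Marked → List Marked → Set
  Child H H' = Saturation.Outcome (childK H H') (Ok H)

  NodeOutcome : List Marked → List Marked → Set
  NodeOutcome H Γ = Interpolant Γ (nodeK H) ⊎ ∃₂ λ v ts → WF (node v ts) × node v ts ⊩* Γ

  NodeSolver : List Marked → Set
  NodeSolver H = ∀ Γ → All Sub Γ → All (Literal ∘ form) Γ → Consistent Γ → NodeOutcome H Γ

  -- Without a clash the literals themselves describe the end, the `■`-literals becoming its
  -- overrides.
  terminal : ∀ H Γ → All Sub Γ → All (Literal ∘ form) Γ → Consistent Γ →
             Saturation.Outcome (terminalK H) (Ok H) Γ
  terminal H Γ sΓ lΓ c with scan {Q = ¬_ ∘ TerminalClash H} (decide ∘ terminalClash? H) lΓ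
  ... | inj₁ bad with find bad
  ... | mk i - _ , m , box = inj₁ (close i (infer₁
          (apply (□-mono (taut₀ λ _ → ⇒I λ p → ⊥-elim (⊥E p)))
                 (hyp {Γ = hyps i Γ (terminalK H)} (∈-++⁺ʳ (map (fmAt i) Γ) (here refl))))
          λ v a h → ⊥-elim (¬E (at-same i (lookup (hyps-marked Γ (terminalK H) h) m)) (a h))))
  ... | mk i s _ , m , sqr n = inj₁ (close i (infer₀ λ v h → ⊥-elim
          (signed-dual s (at-same i (lookup (hyps-marked Γ (terminalK H) h) m))
            (at-same i (lookup (map⁻ (All.tail (hyps-context Γ (terminalK H) h))) n)))))
  terminal H Γ sΓ lΓ c | inj₂ ok =
    inj₂ (end (valuation Γ) (override Γ) , (tt , supported) , tabulate λ m → true-at m (lookup lΓ m))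
    where
    supported : Supported H (end (valuation Γ) (override Γ))
    supported D b eq with override-literal {Γ} b eq
    ... | i , m = i , sub-+ (lookup sΓ m) (■-in (S-refl D)) , λ n → lookup ok m (sqr n)
    true-at : ∀ {u} → u ∈ Γ → Literal (form u) → end (valuation Γ) (override Γ) ⊩ fm u
    true-at {mk i + _} m (var n) = holds (valuation-true m)
    true-at {mk i - _} m (var n) = holds (cong not (valuation-false c m))
    true-at {mk i + _} m (box D) = holds refl
    true-at {mk i - _} m (box D) = ⊥-elim (lookup ok m box)
    true-at {mk i + _} m (sqr D) = holds (cong (fromMaybe _) (override-true m))
    true-at {mk i - _} m (sqr D) = holds (cong (not ∘ fromMaybe _) (override-false c m))

  -- The successor is an end or not, so the interpolants are combined by cases on `□ ⊥'`. This
  -- occurs with both signs, harmlessly, as it contains no atom.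
  merge : ∀ {H H' Γ} → Interpolant Γ (terminalK H) → Interpolant Γ (nodeK H') → Interpolant Γ (childK H H')
  merge {H} {H'} {Γ} (interpolant C g d) (interpolant D g′ d′) =
    interpolant (ite (□ ⊥') C D) (good-ite (good-□ good-⊥) g g′) λ i →
      infer₂ (d i) (d′ i) λ v a b h →
        let γ = hyps-marked Γ (childK H H') h
            θ = hyps-context Γ (childK H H') h
        in sgn-ite i (λ p → a (hyps-intro {Θ = terminalK H} γ (p ∷ ++⁻ʳ (map (□negAt i) H') θ)))
                     (λ n → b (hyps-intro {Θ = nodeK H'} γ (n ∷ ++⁻ˡ (map (□negAt i) H') θ)))

  solve-child : ∀ H H' → NodeSolver H' → ∀ Γ → All Sub Γ → Child H H' Γ
  solve-child H H' solver Γ sΓ =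
    saturate (λ Λ sΛ lΛ → subst Outcome (sym (++-identityʳ Λ)) (leaf Λ sΛ lΛ)) Γ sΓ [] [] []
    where
    open Saturation (childK H H') (Ok H)
    leaf : ∀ Λ → All Sub Λ → All (Literal ∘ form) Λ → Outcome Λ
    leaf Λ sΛ lΛ with consistent? Λ
    ... | inj₁ (i , j , X , p , n) = inj₁ (clash sΛ p n)
    ... | inj₂ c with terminal H Λ sΛ lΛ c | solver Λ sΛ lΛ c
    ... | inj₂ open-end | _ = inj₂ open-end
    ... | inj₁ _ | inj₂ (v , ts , w , h) = inj₂ (node v ts , (w , tt) , h)
    ... | inj₁ I | inj₁ J = inj₁ (merge I J)

  -- Either u is impossible in every successor, or its side proves the modalized
  -- interpolant of the failed successor u ∷ boxes Γ, which the other side refutes.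
  extend-history : ∀ {u Γ H} → Interpolant (u ∷ boxes Γ) (childK H (u ∷ H)) →
                   Interpolant Γ (nodeK (u ∷ H)) → Interpolant Γ (nodeK H)
  extend-history {u} {Γ} {H} (interpolant C g d) (interpolant F g′ e) =
    interpolant (join i (dia i C) F) (good-join i (good-dia i g) g′) side-derivation
    where
    i = side u
    add : ∀ {v j} → v ⊨ □negAt j u → v ⊨* hyps j Γ (nodeK H) → v ⊨* hyps j Γ (nodeK (u ∷ H))
    add p h with hyps-context Γ (nodeK H) h
    ... | n ∷ q = hyps-intro {Θ = nodeK (u ∷ H)} (hyps-marked Γ (nodeK H) h) (n ∷ p ∷ q)
    same : ∀ {v} → (v ⊨* (□ (¬' (sgn i C)) ∷ hyps i Γ (nodeK H)) → v ⊨ □ neg u) →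
           (v ⊨* hyps i Γ (nodeK (u ∷ H)) → v ⊨ sgn i F) →
           v ⊨* hyps i Γ (nodeK H) → v ⊨ sgn i (join i (dia i C) F)
    same {v} a b h with ⊨-dec {v} (□ (¬' (sgn i C)))
    ... | inj₁ p = join-same i (inj₂ (b (add (at-intro i i (a (p ∷ h))) h)))
    ... | inj₂ n = join-same i (inj₁ (dia-same i n))
    side-derivation : ∀ j → hyps j Γ (nodeK H) ⊢ sgn j (join i (dia i C) F)
    side-derivation j with j ≟Side i
    ... | yes refl = infer₂ (step-same {u} {Γ} {H} (d i)) (e i) λ v → same
    ... | no n = infer₂ (step-other {u} {Γ} {H} n (sgn-other i j n) (d j)) (e j) λ v a b h →
          join-any i j (dia-other i j n (a h)) (b (add (at-other j i n) h))

  -- The history gives `□ D`; where `□ ⊥'` fails, `ax3` turns it into `■ D`.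
  node-clash : ∀ {H Γ} → Any (NodeClash H) Γ → Interpolant Γ (nodeK H)
  node-clash {H} {Γ} c with find c
  ... | mk i - _ , m , box n = close i (infer₀ λ v h →
          ⊥-elim (¬E (at-same i (lookup (hyps-marked Γ (nodeK H) h) m))
                     (at-same i (lookup (map⁻ (All.tail (hyps-context Γ (nodeK H) h))) n))))
  ... | mk i - (■ D) , m , sqr n = close i (infer₁ {Γ₁ = []} (weaken (ax (ax3 D))) λ v a h →
          ⊥-elim (impossible (hyps-context Γ (nodeK H) h)
                             (at-same i (lookup (hyps-marked Γ (nodeK H) h) m)) (a [])))
    where
    impossible : ∀ {v} → v ⊨* nodeK H i → v ⊨ ¬' (■ D) → v ⊨ □ D ⇒ ((□ ⊥') ∨' (■ D)) → ⊥
    impossible (p ∷ q) r a with ∨E (⇒E a (at-same i (lookup (map⁻ q) n)))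
    ... | inj₁ b = ¬E p b
    ... | inj₂ b = ¬E r b

  Covers : List Marked → List Tree → Set
  Covers H ts = ∀ {u} → u ∈ candidates → u ∉ H → Any (_⊩ fm u) ts

  -- The demand `mk L - ⊥'` yields a successor, and the demands behind the overrides yield their
  -- witnesses.
  node-WF : ∀ {H ts} v → All (Ok H) ts → Covers H ts → mk L - ⊥' ∉ H → WF (node v ts)
  node-WF {H} {ts} v oks cov n =
    cov (here refl) n , WFs-intro (All.map proj₁ oks) , All.map (λ {t} ok → witnessed t (proj₂ ok)) oks
    where
    witnessed : ∀ t → Supported H t → Witnessed ts t
    witnessed (node _ _) _ = tt
    witnessed (end v o) s D b eq with s D b eq
    ... | i , p , n = cov (sub⇒candidate p) n

  collect : ∀ {H Γ} xs → (∀ {u} → u ∈ xs → u ∉ H → ∃ λ t → Ok H t × t ⊩* (u ∷ Γ)) →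
            ∃ λ ts → All (Ok H) ts × All (_⊩* Γ) ts × (∀ {u} → u ∈ xs → u ∉ H → Any (_⊩ fm u) ts)
  collect [] f = [] , [] , [] , λ ()
  collect {H} (x ∷ xs) f with collect xs (f ∘ there) | x ∈? H
  ... | ts , oks , hs , cov | yes m = ts , oks , hs , λ { (here refl) n → ⊥-elim (n m) ; (there i) → cov i }
  ... | ts , oks , hs , cov | no n with f (here refl) n
  ... | t , ok , p ∷ h = t ∷ ts , ok ∷ oks , h ∷ hs , λ { (here refl) _ → here p ; (there i) n → there (cov i n) }

  -- In the absence of clashes, every refuted `□ D` or `■ D` in `Γ` is a demand outside `H`, hence
  -- met by some tree in `ts`.
  open-node : ∀ {H Γ} → All (Literal ∘ form) Γ → Consistent Γ → All (¬_ ∘ NodeClash H) Γ → mk L - ⊥' ∉ H →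
              All Sub Γ → ∀ {ts} → All (Ok H) ts → All (_⊩* boxes Γ) ts → Covers H ts →
              ∃₂ λ v ts → WF (node v ts) × node v ts ⊩* Γ
  open-node {H} {Γ} lΓ c nc n sΓ {ts} oks hs cov =
    valuation Γ , ts , node-WF {H} (valuation Γ) oks cov n , tabulate λ m → true-at m (lookup lΓ m)
    where
    t₀ = node (valuation Γ) ts
    necessary : ∀ {i D} → mk i + (□ D) ∈ Γ → t₀ ⊩ □ D
    necessary m = let p , q = proj₁ boxes-literal m in □I (All.map (λ h → lookup h p , lookup h q) hs)
    necessary■ : ∀ {i D} → mk i + (■ D) ∈ Γ → t₀ ⊩ ■ D
    necessary■ m = let p , q = proj₂ boxes-literal m in
      □⇒■-node (□I (All.map (λ {t} h → lookup h p , ■⇒□ t (lookup h q)) hs))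
    refutable : ∀ {i D} → Sub (mk i - D) → mk i - D ∉ H → t₀ ⊩ ¬' (□ D)
    refutable s n = ¬I λ p → refuted (cov (sub⇒candidate s) n) (□E p) λ r q → ¬E r (proj₁ q)
    true-at : ∀ {u} → u ∈ Γ → Literal (form u) → t₀ ⊩ fm u
    true-at {mk i + _} m (var n) = holds (valuation-true m)
    true-at {mk i - _} m (var n) = holds (cong not (valuation-false c m))
    true-at {mk i + _} m (box D) = necessary m
    true-at {mk i - _} m (box D) =
      refutable (sub-+ (lookup sΓ m) (□-in (S-refl D))) λ k → lookup nc m (box k)
    true-at {mk i + _} m (sqr D) = necessary■ m
    true-at {mk i - _} m (sqr D) = ¬I λ p →
      ¬E (refutable (sub-+ (lookup sΓ m) (■-in (S-refl D))) λ k → lookup nc m (sqr k)) (■⇒□ t₀ p)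

  -- Only new candidates join a history, and there are finitely many; `rest` contains all those
  -- still absent and shrinks at each addition.
  history-induction : (Q : List Marked → Set) →
                      (∀ H → (∀ {u} → u ∈ candidates → u ∉ H → Q (u ∷ H)) → Q H) → ∀ H → Q H
  history-induction Q step H₀ = go H₀ candidates (λ m _ → m) (<-wellFounded _)
    where
    go : ∀ H rest → (∀ {u} → u ∈ candidates → u ∉ H → u ∈ rest) → Acc _<_ (length rest) → Q H
    go H rest covers (acc rs) = step H λ {u} m n →
      let other? = λ x → ¬? (x ≟M u) in
      go (u ∷ H) (filter other? rest)
         (λ m′ n′ → ∈-filter⁺ other? (covers m′ (n′ ∘ there)) (n′ ∘ here))
         (rs (filter-notAll other? rest (Any.map (λ { refl d → d refl }) (covers m n))))

  search : ∀ {H Γ} → All Sub Γ → (∀ {u} → u ∈ candidates → u ∉ H → NodeSolver (u ∷ H)) →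
           (∃ λ u → u ∈ candidates × u ∉ H × Interpolant (u ∷ Γ) (childK H (u ∷ H))) ⊎
           (∀ {u} → u ∈ candidates → u ∉ H → ∃ λ t → Ok H t × t ⊩* (u ∷ Γ))
  search {H} {Γ} sΓ rec with scan {R = _∈ candidates} test (tabulate id)
    where
    test : ∀ {u} → u ∈ candidates →
           (u ∈ candidates × u ∉ H × Interpolant (u ∷ Γ) (childK H (u ∷ H))) ⊎
           (u ∉ H → ∃ λ t → Ok H t × t ⊩* (u ∷ Γ))
    test {u} m with u ∈? H
    ... | yes k = inj₂ λ n → ⊥-elim (n k)
    ... | no n with solve-child H (u ∷ H) (rec m n) (u ∷ Γ) (candidate⇒sub m ∷ sΓ)
    ... | inj₁ I = inj₁ (m , n , I)
    ... | inj₂ o = inj₂ λ _ → o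
  ... | inj₁ c = inj₁ (Any.satisfied c)
  ... | inj₂ h = inj₂ λ m → lookup h m

  solve-node : ∀ H → NodeSolver H
  solve-node = history-induction NodeSolver step
    where
    step : ∀ H → (∀ {u} → u ∈ candidates → u ∉ H → NodeSolver (u ∷ H)) → NodeSolver H
    step H rec Γ sΓ lΓ c with search {H} (boxes-sub Γ sΓ) rec
    -- The failed demand joins the history of the same world, which is then solved anew.
    ... | inj₁ (u , m , n , I) with rec m n Γ sΓ lΓ c
    ...   | inj₁ J = inj₁ (extend-history I J)
    ...   | inj₂ o = inj₂ o
    step H rec Γ sΓ lΓ c | inj₂ succs
      with mk L - ⊥' ∈? H | scan {Q = ¬_ ∘ NodeClash H} (decide ∘ nodeClash? H) lΓ
    -- The history entry `mk L - ⊥'` says `□ ⊥'`, which contradicts the head of `nodeK`.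
    ... | yes k | _ = inj₁ (close L (infer₀ λ v h →
            ⊥-elim (¬E (All.head (hyps-context Γ (nodeK H) h))
                       (lookup (map⁻ (All.tail (hyps-context Γ (nodeK H) h))) k))))
    ... | no _ | inj₁ bad = inj₁ (node-clash bad)
    ... | no n | inj₂ nc =
      let ts , oks , hs , cov = collect candidates succs in inj₂ (open-node lΓ c nc n sΓ oks hs cov)

  -- Interpolating an implication

  Result : Set
  Result = ∃ λ C → Good + C × GR● (A ⇒ C) × GR● (C ⇒ B)

  neg■-theorem : ∀ u → GR● (neg u) → GR● (neg■ u)
  neg■-theorem (mk i + X) p = ■rosser p
  neg■-theorem (mk i - X) p = ■nec p

  at-theorem : ∀ i j {X} → GR● X → GR● (at i j X)
  at-theorem L L p = p
  at-theorem L R p = taut₀ λ _ → ⊤I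
  at-theorem R L p = taut₀ λ _ → ⊤I
  at-theorem R R p = p

  childK-theorems : ∀ {H} → All (GR● ∘ neg) H → ∀ i → All GR● (childK H H i)
  childK-theorems h i =
    ++⁺ (map⁺ (All.map (λ {u} p → at-theorem i (side u) (nec p)) h))
        (map⁺ (All.map (λ {u} p → at-theorem i (side u) (neg■-theorem u p)) h))

  opposite : Side → Side
  opposite L = R
  opposite R = L

  opposite-≢ : ∀ i → opposite i ≢ i
  opposite-≢ L ()
  opposite-≢ R ()

  -- The history `H` contributes only theorems, so the other side proves its half of the separation
  -- outright. Hence `□ neg u ⇒ neg u` is a theorem, and Löb's principle removes its premise.
  impossible-theorem : ∀ {u H} → All (GR● ∘ neg) H → Interpolant (u ∷ []) (childK H (u ∷ H)) → GR● (neg u)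
  impossible-theorem {u} {H} h (interpolant C _ d) =
    mp (theorem löb-premise) (theorem (löb-cut {Δ = []} [] löb-premise))
    where
    i = side u
    j = opposite i
    j≢i = opposite-≢ i
    same : fmAt i u ∷ □negAt i u ∷ [] ⊢ sgn i C
    same = cut (hyp (here refl) ∷ hyp (there (here refl)) ∷ All.map weaken (childK-theorems h i)) (d i)
    other : [] ⊢ sgn j C
    other = cut (infer₀ (λ v _ → at-other j i j≢i) ∷ infer₀ (λ v _ → at-other j i j≢i) ∷
                 All.map weaken (childK-theorems h j)) (d j)
    löb-premise : □ neg u ∷ [] ⊢ neg u
    löb-premise = infer₂ same other λ { v a b (□n ∷ []) → dual-intro (sign u) λ p →
      ¬E (sgn-other i j j≢i (b [])) (a (at-intro i i p ∷ at-intro i i □n ∷ [])) }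

  -- The history now lists formulas refuted outright. The state of `A` and `¬' B` is placed below an
  -- auxiliary root: ends need siblings as witnesses, and `sound` yields only `□ (A ⇒ B)`.
  interpolate : GR● (A ⇒ B) → Result
  interpolate ⊢A⇒B = history-induction (λ H → All (GR● ∘ neg) H → Result) step [] []
    where
    step : ∀ H → (∀ {u} → u ∈ candidates → u ∉ H → All (GR● ∘ neg) (u ∷ H) → Result) →
           All (GR● ∘ neg) H → Result
    step H rec h with search {H} {[]} [] (λ {u} _ _ → solve-node (u ∷ H))
    ... | inj₁ (u , m , n , I) = rec m n (impossible-theorem h I ∷ h)
    -- Refuted formulas fail everywhere, so one history serves both for the siblings of the state
    -- and for its successors.
    ... | inj₂ succs with mk L - ⊥' ∈? H
                        | solve-child H H (solve-node H) (mk L + A ∷ mk R - B ∷ [])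
                                      (left (S-refl A) ∷ right (S-refl B) ∷ [])
    -- In this case `⊥'` is itself a theorem, and it serves as the interpolant.
    ... | yes k | _ =
      ⊥' , good-⊥ , taut₁ (lookup h k) (λ v p → ⊥-elim (⊥E p)) , taut₀ λ v → ⇒I λ p → ⊥-elim (⊥E p)
    ... | no _ | inj₁ (interpolant C g d) =
      C , g
      , theorem (cut (hyp (here refl) ∷ infer₀ (λ _ _ → ⊤I) ∷ All.map weaken (childK-theorems h L)) (d L))
      , theorem (infer₁ {C ∷ []} {Γ₁ = ¬' B ∷ []}
          (cut (infer₀ (λ _ _ → ⊤I) ∷ hyp (here refl) ∷ All.map weaken (childK-theorems h R)) (d R))
          λ { v a (c ∷ []) → ¬¬E λ n → ¬E (a (¬I n ∷ [])) c })
    ... | no n | inj₂ (t , ok , a ∷ b ∷ []) =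
      -- The root has the countermodel `t` and a witness of every demand outside `H` as its
      -- successors; its valuation is arbitrary.
      let ts , oks , _ , cov = collect {Γ = []} candidates succs
          w = node-WF {H} (λ _ → false) (ok ∷ oks) (λ m k → there (cov m k)) n
      in ⊥-elim (¬E b (⇒E (proj₁ (□-child (sound ⊢A⇒B (node (λ _ → false) (t ∷ ts)) w) (here refl))) a))

theorem5p4 : LyndonIP
    × ((A B : Fm) → GR● (A ⇒ B) →
    Σ Fm (λ C → LyndonInterpolant A B C
    × ((s : Sign) (D : Fm) → S s C (■ D) → S s A (■ D) × S s B (■ D))))
theorem5p4 = (λ A B p → let C , i , _ = main A B p in C , i) , main
  where
  main : (A B : Fm) → GR● (A ⇒ B) →
    Σ Fm (λ C → LyndonInterpolant A B C
    × ((s : Sign) (D : Fm) → S s C (■ D) → S s A (■ D) × S s B (■ D)))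
  main A B p with interpolate A B p
  ... | C , good g , a , b = C , ((λ s n → g s (var n) (var n)) , a , b) , λ s D → g s (■ D) (sqr D)
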